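{- There exists $N_0$ such that for every integer $n\ge N_0$, the hypercube $Q_n$ has $3$ pairwise almost orthogonal symmetric chain decompositions.
   Context: $Q_n$ denotes the Boolean lattice of all subsets of $[n]=\{1,\dots,n\}$ ordered by inclusion. A symmetric chain in $Q_n$ is a chain consisting of exactly one subset of each size $j,j+1,\dots,n-j$ for some $j$; a symmetric chain decomposition of $Q_n$ is a partition of $Q_n$ into symmetric chains (exactly one of its chains contains both $\varnothing$ and $[n]$). Two symmetric chain decompositions $\mathcal{F},\mathcal{G}$ of $Q_n$ are almost orthogonal if for every chain $A\in\mathcal{F}$ and $B\in\mathcal{G}$ we have $|A\cap B|\le 1$, except when $A$ and $B$ both contain $\varnothing$ and $[n]$, in which case $|A\cap B|=2$. A family of symmetric chain decompositions is almost orthogonal if every pair of them is. -}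

module Defs where

open import Data.Nat using (ℕ; suc; _+_; _*_; _∸_; _≤_)
open import Data.Bool using (Bool)
import Data.Bool.Properties as BoolP
open import Data.Fin using (Fin; toℕ)
open import Data.Fin.Subset using (Subset; _⊆_; ∣_∣; ⊥; ⊤)
open import Data.List using (List; length; lookup; filter)
open import Data.List.Relation.Unary.Linked using (Linked)
import Data.List.Membership.Propositional as LMem
import Data.List.Membership.DecPropositional as DecMem
open import Data.Vec.Properties using (≡-dec)
open import Data.Product using (Σ; _×_)
open import Relation.Binary.PropositionalEquality using (_≡_)
open import Relation.Binary.Definitions using (DecidableEquality)

-- Elements of Q_n: subsets of [n] = Fin n, as characteristic vectors.
-- Inclusion is Data.Fin.Subset._⊆_, size is ∣_∣.

_≟S_ : {n : ℕ} → DecidableEquality (Subset n)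
_≟S_ = ≡-dec BoolP._≟_

_∈L_ : {n : ℕ} → Subset n → List (Subset n) → Set
S ∈L C = S LMem.∈ C

record IsSymmetricChain (n : ℕ) (C : List (Subset n)) : Set where
  field
    j       : ℕ
    2j≤n    : 2 * j ≤ n
    len     : length C ≡ suc (n ∸ 2 * j)
    sizes   : (i : Fin (length C)) → ∣ lookup C i ∣ ≡ j + toℕ i
    chain   : Linked _⊆_ C

record IsSCD (n : ℕ) (F : List (List (Subset n))) : Set where
  field
    symmetric : (i : Fin (length F)) → IsSymmetricChain n (lookup F i)
    partition : (S : Subset n) →
                Σ (Fin (length F)) λ i →
                  (S ∈L lookup F i) × ((k : Fin (length F)) → S ∈L lookup F k → k ≡ i)

-- |A ∩ B| for chains A, B (lists of distinct subsets): number of members of A lying in B.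
∣_∩C_∣ : {n : ℕ} → List (Subset n) → List (Subset n) → ℕ
∣ A ∩C B ∣ = length (filter (λ S → DecMem._∈?_ _≟S_ S B) A)

IsFullChain : {n : ℕ} → List (Subset n) → Set
IsFullChain A = (⊥ ∈L A) × (⊤ ∈L A)

AlmostOrthogonal : (n : ℕ) → List (List (Subset n)) → List (List (Subset n)) → Set
AlmostOrthogonal n F G =
  (a : Fin (length F)) (b : Fin (length G)) →
  let A = lookup F a ; B = lookup G b in
  (IsFullChain A × IsFullChain B → ∣ A ∩C B ∣ ≡ 2) ×
  ((IsFullChain A × IsFullChain B → Data.Empty.⊥) → ∣ A ∩C B ∣ ≤ 1)
  where import Data.Empty

{-# OPTIONS --safe #-}
module Submission where

-- If G and F are symmetric chain decompositions of Q_b and Q_n, then Q_(b+n) is the disjoint union of the grids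
-- D × C with D ∈ G and C ∈ F, and each grid is tiled by symmetric chains. Given almost orthogonal G, G′ and F, F′,
-- two points shared by a chain of D × C and a chain of D′ × C′ must differ by exchanging ⊥ and ⊤ in a coordinate, so
-- only a full D or C causes trouble. If the grid is large, it has a tiling none of whose chains joins both ends
-- of a row or column. If D is full and |C| ≤ 2, then some chain must contain the whole row of a point of C; we
-- let this be the row of a label of C, and ask that labels of different decompositions be distinct. Likewise
-- with C full and |D| = 2.
--
-- To propagate labels of the chains with at most two members, the three decompositions of Q_b carry a mark
-- on every chain, again with distinct marks for distinct decompositions, and each grid is tiled in such a way
-- that its chain with at most two members, if any, contains a point whose first coordinate is marked. Such marked
-- decompositions exist for b = 5 and b = 7, and every n ≥ 24 has the form 5x + 7y.

open import Defs
import Algebra.Properties.CommutativeSemigroup as CommutativeSemigroupProperties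
import Algebra.Solver.CommutativeMonoid as CommutativeMonoidSolver
open import Algebra.Bundles using (CommutativeMonoid)
open import Data.Empty using (⊥-elim)
open import Data.Fin as Fin using (Fin; toℕ)
open import Data.Fin.Patterns using (0F; 1F; 2F)
import Data.Fin.Properties as Fin
open import Data.Fin.Subset using (Subset; _⊆_; ∣_∣; ⊥; ⊤; inside; outside)
open import Data.Fin.Subset.Properties
  using (⊆-refl; ⊆-trans; ⊆-antisym; ⊥⊆; ⊆⊤; out⊆; in⊆in; drop-∷-⊆; ∣⊥∣≡0; ∣⊤∣≡n; _⊆?_; anySubset?)
open import Data.List using (List; []; _∷_; _++_; _∷ʳ_; map; concat; concatMap; length; lookup; filter; iterate; drop;
  cartesianProduct)
open import Data.List.Membership.Propositional using (_∈_; _∉_)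
import Data.List.Membership.DecPropositional as DecMembership
open import Data.List.Membership.Propositional.Properties
open import Data.List.Properties using (map-++; map-∘; length-++; length-map; ∷-injectiveˡ; concat-map; concat-++;
  ++-identityʳ; ++-assoc; cartesianProductWith-distribʳ-++; cartesianProductWith-zeroʳ)
open import Data.List.Relation.Binary.Permutation.Propositional
  using (_↭_; ↭-refl; ↭-sym; ↭-reflexive; ↭⇒↭ₛ; module PermutationReasoning)
open import Data.List.Relation.Binary.Permutation.Propositional.Properties as ↭
  using (++⁺; ++⁺ˡ; ++-comm; ++-commutativeMonoid; ∈-resp-↭)
import Data.List.Relation.Binary.Permutation.Setoid.Properties as ↭ₛ
open import Data.List.Relation.Unary.All as All using (All; []; _∷_; all?)
import Data.List.Relation.Unary.All.Properties as All
open import Data.List.Relation.Unary.AllPairs using ([]; _∷_)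
open import Data.List.Relation.Unary.Any as Any using (Any; here; there; any?)
import Data.List.Relation.Unary.Any.Properties as Any
open import Data.List.Relation.Unary.Linked using (Linked; []; [-]; _∷_)
open import Data.List.Relation.Unary.Unique.DecPropositional using (unique?)
open import Data.List.Relation.Unary.Unique.Propositional using (Unique)
import Data.List.Relation.Unary.Unique.Propositional.Properties as Unique
open import Data.Nat as ℕ using (ℕ; zero; suc; _+_; _*_; _∸_; _≤_; _<_; z≤n; s≤s; _≤?_; _≡ᵇ_)
open import Data.Nat.DivMod using (_/_; _%_)
open import Data.Nat.Properties using (≤-refl; ≤-trans; ≤-reflexive; 1+n≰n; n≤1+n; +-suc; +-comm; +-identityʳ;
  +-mono-≤; +-monoʳ-≤; +-∸-assoc; m+n∸n≡m; [m+n]∸[m+o]≡n∸o; m≤n⇒∃[o]m+o≡n; +-commutativeSemigroup)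
open import Data.Nat.Tactic.RingSolver using (solve-∀)
open import Data.Product using (Σ; ∃; ∃₂; _×_; _,_; proj₁; proj₂; swap)
open import Data.Sum using (_⊎_; inj₁; inj₂)
import Data.Vec as Vec
import Data.Vec.Properties as Vec
open import Function using (_∘_; id)
open import Relation.Binary.PropositionalEquality
  using (_≡_; _≢_; refl; sym; trans; cong; cong₂; subst; subst₂; setoid; module ≡-Reasoning)
open import Relation.Nullary using (¬_; Dec; yes; no; ¬?; contradiction)
open import Relation.Nullary.Decidable using (_×-dec_; _⊎-dec_; _→-dec_; toWitness; map′; decidable-stable)

open CommutativeSemigroupProperties +-commutativeSemigroup using () renaming (interchange to +-interchange)

private variable
  A B : Set
  b n : ℕ

-- Linked lists with both endpoints as indices.

data Path {A : Set} (R : A → A → Set) : A → A → List A → Set where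
  stop : ∀ {a} → Path R a a (a ∷ [])
  _◅_  : ∀ {a b c xs} → R a b → Path R b c xs → Path R a c (a ∷ xs)

infixr 5 _◅_

module _ {R : A → A → Set} where

  first∈ : ∀ {a c xs} → Path R a c xs → a ∈ xs
  first∈ stop    = here refl
  first∈ (_ ◅ _) = here refl

  last∈ : ∀ {a c xs} → Path R a c xs → c ∈ xs
  last∈ stop    = here refl
  last∈ (_ ◅ p) = there (last∈ p)

  path-length : ∀ {a c xs} → Path R a c xs → 1 ≤ length xs
  path-length stop    = s≤s z≤n
  path-length (_ ◅ _) = s≤s z≤n

  path-++ : ∀ {a b c d xs ys} → Path R a b xs → R b c → Path R c d ys → Path R a d (xs ++ ys)
  path-++ stop    r q = r ◅ q
  path-++ (s ◅ p) r q = s ◅ path-++ p r q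

  path-∷ʳ : ∀ {a b c xs} → Path R a b xs → R b c → Path R a c (xs ∷ʳ c)
  path-∷ʳ p r = path-++ p r stop

  path-map : ∀ {S : B → B → Set} {f : A → B} → (∀ {a b} → R a b → S (f a) (f b)) →
             ∀ {a c xs} → Path R a c xs → Path S (f a) (f c) (map f xs)
  path-map g stop    = stop
  path-map g (r ◅ p) = g r ◅ path-map g p

  -- A path is built from its first step, but hooks also cut a list at its end; this exposes the
  -- last step while keeping the head of the list visible.
  unsnoc : ∀ {a b c xs} → R a b → Path R b c xs →
           ∃₂ λ d ys → Path R a d (a ∷ ys) × R d c × xs ≡ ys ∷ʳ c
  unsnoc r stop = _ , [] , stop , r , refl
  unsnoc r (s ◅ p) with unsnoc s p
  ... | d , ys , q , t , refl = d , _ ∷ ys , r ◅ q , t , refl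

  unsnoc₂ : ∀ {a b c d xs} → R a b → R b c → Path R c d xs →
            Σ A λ e → Σ A λ f → Σ (List A) λ ys →
            Path R a e (a ∷ ys) × R e f × R f d × b ∷ xs ≡ (ys ∷ʳ f) ∷ʳ d
  unsnoc₂ r s p with unsnoc s p
  ... | f , _ , q , v , refl with q
  ... | stop   = _ , _ , [] , stop , r , v , refl
  ... | t ◅ q′ with unsnoc r (t ◅ q′)
  ...   | e , ys , q″ , u , eq = e , f , ys , q″ , u , v , cong (_∷ʳ _) eq

  data LastView : A → A → List A → Set where
    single : ∀ {a} → LastView a a (a ∷ [])
    snoc   : ∀ {a b c xs} → Path R a b (a ∷ xs) → R b c → LastView a c (a ∷ (xs ∷ʳ c))

  lastView : ∀ {a c xs} → Path R a c xs → LastView a c xs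
  lastView stop = single
  lastView (r ◅ p) with unsnoc r p
  ... | _ , _ , q , s , refl = snoc q s

  module Order {_≼_ : A → A → Set} (≼-refl : ∀ {a} → a ≼ a)
               (≼-trans : ∀ {a b c} → a ≼ b → b ≼ c → a ≼ c)
               (R⇒≼ : ∀ {a b} → R a b → a ≼ b) where

    first-≼ : ∀ {a c x xs} → Path R a c xs → x ∈ xs → a ≼ x
    first-≼ stop    (here refl) = ≼-refl
    first-≼ (r ◅ p) (here refl) = ≼-refl
    first-≼ (r ◅ p) (there m)   = ≼-trans (R⇒≼ r) (first-≼ p m)

    ≼-last : ∀ {a c x xs} → Path R a c xs → x ∈ xs → x ≼ c
    ≼-last stop    (here refl) = ≼-refl
    ≼-last (r ◅ p) (here refl) = ≼-trans (R⇒≼ r) (first-≼ p (last∈ p))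
    ≼-last (r ◅ p) (there m)   = ≼-last p m

    comparable : ∀ {a c x y xs} → Path R a c xs → x ∈ xs → y ∈ xs → x ≼ y ⊎ y ≼ x
    comparable p       (here refl) m           = inj₁ (subst (_≼ _) (head≡ p) (first-≼ p m))
      where
      head≡ : ∀ {a c x xs} → Path R a c (x ∷ xs) → a ≡ x
      head≡ stop    = refl
      head≡ (_ ◅ _) = refl
    comparable p@(_ ◅ _) (there k) (here refl) = inj₂ (first-≼ p (there k))
    comparable (r ◅ p) (there k)   (there m)   = comparable p k m

-- Covers and symmetric chains, in one cube and in a product of two.

infix 4 _⋖_ _⋖₂_

record _⋖_ {n : ℕ} (S T : Subset n) : Set where
  constructor cover
  field
    ⋖⇒⊆ : S ⊆ T
    size : ∣ T ∣ ≡ suc ∣ S ∣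
open _⋖_

data _⋖₂_ {b n : ℕ} : Subset b × Subset n → Subset b × Subset n → Set where
  left  : ∀ {S S′ T} → S ⋖ S′ → (S , T) ⋖₂ (S′ , T)
  right : ∀ {S T T′} → T ⋖ T′ → (S , T) ⋖₂ (S , T′)

size₂ : Subset b × Subset n → ℕ
size₂ (S , T) = ∣ S ∣ + ∣ T ∣

⋖-< : {S T : Subset n} → S ⋖ T → ∣ S ∣ < ∣ T ∣
⋖-< r = ≤-reflexive (sym (size r))

⋖-≤ : {S T : Subset n} → S ⋖ T → ∣ S ∣ ≤ ∣ T ∣
⋖-≤ r = ≤-trans (n≤1+n _) (⋖-< r)

module Size {n} = Order {R = _⋖_ {n}} {_≼_ = λ S T → ∣ S ∣ ≤ ∣ T ∣} ≤-refl ≤-trans ⋖-≤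

before-∉ : ∀ {a b c : Subset n} {xs} → a ⋖ b → Path _⋖_ b c xs → a ∉ xs
before-∉ r p m = 1+n≰n (≤-trans (⋖-< r) (Size.first-≼ p m))

after-∉ : ∀ {a b c : Subset n} {xs} → Path _⋖_ a b xs → b ⋖ c → c ∉ xs
after-∉ p r m = 1+n≰n (≤-trans (⋖-< r) (Size.≼-last p m))

SymmetricChain : List (Subset n) → Set
SymmetricChain {n} C = ∃₂ λ S T → Path _⋖_ S T C × ∣ S ∣ + ∣ T ∣ ≡ n

-- A record instead of a bare equation of sizes, so that the endpoints `s` and `t` can be inferred
-- from the type.
record Centred {b n : ℕ} (N : ℕ) (s t : Subset b × Subset n) : Set where
  constructor centred
  field
    size-sum : size₂ s + size₂ t ≡ N

SymmetricChain₂ : ℕ → List (Subset b × Subset n) → Set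
SymmetricChain₂ N X = ∃₂ λ s t → Path _⋖₂_ s t X × Centred N s t

-- Cartesian products of lists up to permutation.

module _ {A : Set} where
  open CommutativeSemigroupProperties (CommutativeMonoid.commutativeSemigroup (++-commutativeMonoid {A = A})) public
    using () renaming (interchange to ++-interchange)
  open CommutativeMonoidSolver (++-commutativeMonoid {A = A}) public
    using (_⊕_; _⊜_) renaming (solve to ++-solve)

product-++ʳ : ∀ (xs : List A) (ys zs : List B) →
              cartesianProduct xs (ys ++ zs) ↭ cartesianProduct xs ys ++ cartesianProduct xs zs
product-++ʳ []       ys zs = ↭-refl
product-++ʳ (x ∷ xs) ys zs = begin
  map (x ,_) (ys ++ zs) ++ cartesianProduct xs (ys ++ zs)
    ↭⟨ ++⁺ (↭-reflexive (map-++ (x ,_) ys zs)) (product-++ʳ xs ys zs) ⟩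
  (map (x ,_) ys ++ map (x ,_) zs) ++ (cartesianProduct xs ys ++ cartesianProduct xs zs)
    ↭⟨ ++-interchange (map (x ,_) ys) (map (x ,_) zs) (cartesianProduct xs ys) (cartesianProduct xs zs) ⟩
  (map (x ,_) ys ++ cartesianProduct xs ys) ++ (map (x ,_) zs ++ cartesianProduct xs zs) ∎
  where open PermutationReasoning

product-[-] : ∀ (xs : List A) (y : B) → cartesianProduct xs (y ∷ []) ≡ map (_, y) xs
product-[-] []       y = refl
product-[-] (x ∷ xs) y = cong ((x , y) ∷_) (product-[-] xs y)

product-∷ʳ : ∀ (xs : List A) (ys : List B) y →
             cartesianProduct xs (ys ∷ʳ y) ↭ map (_, y) xs ++ cartesianProduct xs ys
product-∷ʳ xs ys y = begin
  cartesianProduct xs (ys ∷ʳ y)                               ↭⟨ product-++ʳ xs ys (y ∷ []) ⟩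
  cartesianProduct xs ys ++ cartesianProduct xs (y ∷ [])      ≡⟨ cong (cartesianProduct xs ys ++_) (product-[-] xs y) ⟩
  cartesianProduct xs ys ++ map (_, y) xs                     ↭⟨ ++-comm (cartesianProduct xs ys) _ ⟩
  map (_, y) xs ++ cartesianProduct xs ys                     ∎
  where open PermutationReasoning

product-swap : ∀ (xs : List A) (ys : List B) → map swap (cartesianProduct ys xs) ↭ cartesianProduct xs ys
product-swap xs [] = ↭-reflexive (sym (cartesianProductWith-zeroʳ _,_ xs))
product-swap xs (y ∷ ys) = begin
  map swap (map (y ,_) xs ++ cartesianProduct ys xs)              ≡⟨ map-++ swap (map (y ,_) xs) _ ⟩
  map swap (map (y ,_) xs) ++ map swap (cartesianProduct ys xs)
    ↭⟨ ++⁺ (↭-reflexive (trans (sym (map-∘ xs)) (sym (product-[-] xs y)))) (product-swap xs ys) ⟩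
  cartesianProduct xs (y ∷ []) ++ cartesianProduct xs ys          ↭⟨ product-++ʳ xs (y ∷ []) ys ⟨
  cartesianProduct xs (y ∷ ys)                                    ∎
  where open PermutationReasoning

-- Tilings of a grid by symmetric chains, and the hooks they are built from.

record Tiling {b n : ℕ} (N : ℕ) (Q : List (Subset b × Subset n) → Set)
              (xs : List (Subset b)) (ys : List (Subset n)) : Set where
  constructor tiling
  field
    chains : List (List (Subset b × Subset n))
    tiles  : concat chains ↭ cartesianProduct xs ys
    good   : All (λ X → SymmetricChain₂ N X × Q X) chains

mapTiling : ∀ {N Q Q′} {xs : List (Subset b)} {ys : List (Subset n)} →
            (∀ {X} → (∀ {x y} → (x , y) ∈ X → x ∈ xs × y ∈ ys) → Q X → Q′ X) →
            Tiling N Q xs ys → Tiling N Q′ xs ys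
mapTiling f (tiling H t g) = tiling H t (All.tabulate λ X∈H →
  let c , q = All.lookup g X∈H
  in c , f (λ m → ∈-cartesianProduct⁻ _ _ (∈-resp-↭ t (∈-concat⁺′ m X∈H))) q)

⋖₂-swap : {s t : Subset b × Subset n} → s ⋖₂ t → swap s ⋖₂ swap t
⋖₂-swap (left r)  = right r
⋖₂-swap (right r) = left r

size₂-swap : (s : Subset b × Subset n) → size₂ (swap s) ≡ size₂ s
size₂-swap (S , T) = +-comm ∣ T ∣ ∣ S ∣

centred-swap : ∀ {N} {s t : Subset b × Subset n} → Centred N s t → Centred N (swap s) (swap t)
centred-swap {s = s} {t} (centred e) = centred (trans (cong₂ _+_ (size₂-swap s) (size₂-swap t)) e)

-- Transposing the grid allows each construction to be carried out in one orientation only.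
swapTiling : ∀ {N Q} {xs : List (Subset b)} {ys : List (Subset n)} →
             Tiling N (Q ∘ map swap) ys xs → Tiling N Q xs ys
swapTiling {xs = xs} {ys} (tiling H t g) = tiling (map (map swap) H)
  (begin
    concat (map (map swap) H)            ≡⟨ concat-map H ⟩
    map swap (concat H)                  ↭⟨ ↭.map⁺ swap t ⟩
    map swap (cartesianProduct ys xs)    ↭⟨ product-swap xs ys ⟩
    cartesianProduct xs ys               ∎)
  (All.map⁺ (All.map (λ { ((s , t , p , e) , q) →
    (swap s , swap t , path-map ⋖₂-swap p , centred-swap e) , q }) g))
  where open PermutationReasoning

-- Without its first column and last row, a grid has a bottom corner one larger and a top corner one
-- smaller, so the sum of their sizes is unchanged.
centred-columnRow : ∀ {N} {x₀ x₁ xₘ : Subset b} {y₀ yₖ yₗ : Subset n} →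
          Centred N (x₀ , y₀) (xₘ , yₗ) → x₀ ⋖ x₁ → yₖ ⋖ yₗ → Centred N (x₁ , y₀) (xₘ , yₖ)
centred-columnRow {x₀ = x₀} {x₁} {xₘ} {y₀} {yₖ} {yₗ} (centred e) r s = centred (trans (begin
  (∣ x₁ ∣ + ∣ y₀ ∣) + (∣ xₘ ∣ + ∣ yₖ ∣)      ≡⟨ cong (λ k → (k + ∣ y₀ ∣) + (∣ xₘ ∣ + ∣ yₖ ∣)) (size r) ⟩
  (suc ∣ x₀ ∣ + ∣ y₀ ∣) + (∣ xₘ ∣ + ∣ yₖ ∣)  ≡⟨ rearrange (∣ x₀ ∣ + ∣ y₀ ∣) (∣ xₘ ∣) (∣ yₖ ∣) ⟩
  (∣ x₀ ∣ + ∣ y₀ ∣) + (∣ xₘ ∣ + suc ∣ yₖ ∣)  ≡⟨ cong (λ k → (∣ x₀ ∣ + ∣ y₀ ∣) + (∣ xₘ ∣ + k)) (size s) ⟨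
  (∣ x₀ ∣ + ∣ y₀ ∣) + (∣ xₘ ∣ + ∣ yₗ ∣)      ∎) e)
  where
  open ≡-Reasoning
  rearrange : ∀ i j k → suc i + (j + k) ≡ i + (j + suc k)
  rearrange = solve-∀

centred-rowColumn : ∀ {N} {x₀ xₖ xₘ : Subset b} {y₀ y₁ yₗ : Subset n} →
          Centred N (x₀ , y₀) (xₘ , yₗ) → xₖ ⋖ xₘ → y₀ ⋖ y₁ → Centred N (x₀ , y₁) (xₖ , yₗ)
centred-rowColumn e r s = centred-swap (centred-columnRow (centred-swap e) s r)

rowTiling : ∀ {N Q} {x₀ xₘ : Subset b} {y : Subset n} {xs} → Path _⋖_ x₀ xₘ xs →
            Centred N (x₀ , y) (xₘ , y) → Q (map (_, y) xs) → Tiling N Q xs (y ∷ [])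
rowTiling {y = y} {xs} p e q = tiling (map (_, y) xs ∷ [])
  (↭-reflexive (trans (++-identityʳ _) (sym (product-[-] xs y))))
  (((_ , _ , path-map left p , e) , q) ∷ [])

columnTiling : ∀ {N Q} {x : Subset b} {y₀ yₗ : Subset n} {ys} → Path _⋖_ y₀ yₗ ys →
               Centred N (x , y₀) (x , yₗ) → Q (map (x ,_) ys) → Tiling N Q (x ∷ []) ys
columnTiling p e q = tiling (_ ∷ []) ↭-refl (((_ , _ , path-map right p , e) , q) ∷ [])

-- Splits off the chain that goes up the first column and then along the last row.
columnRowTiling : ∀ {N Q} {x₀ x₁ xₘ : Subset b} {y₀ yₖ yₗ : Subset n} {xs ys} →
        x₀ ⋖ x₁ → Path _⋖_ x₁ xₘ xs → Path _⋖_ y₀ yₖ ys → yₖ ⋖ yₗ →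
        Centred N (x₀ , y₀) (xₘ , yₗ) →
        Q (map (x₀ ,_) (ys ∷ʳ yₗ) ++ map (_, yₗ) xs) →
        Tiling N Q xs ys → Tiling N Q (x₀ ∷ xs) (ys ∷ʳ yₗ)
columnRowTiling {x₀ = x₀} {yₗ = yₗ} {xs} {ys} r p q s e Qh (tiling H t g) = tiling _
  (begin
    (map (x₀ ,_) (ys ∷ʳ yₗ) ++ map (_, yₗ) xs) ++ concat H
      ↭⟨ ++⁺ˡ (map (x₀ ,_) (ys ∷ʳ yₗ) ++ map (_, yₗ) xs) t ⟩
    (map (x₀ ,_) (ys ∷ʳ yₗ) ++ map (_, yₗ) xs) ++ cartesianProduct xs ys
      ≡⟨ ++-assoc (map (x₀ ,_) (ys ∷ʳ yₗ)) _ _ ⟩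
    map (x₀ ,_) (ys ∷ʳ yₗ) ++ (map (_, yₗ) xs ++ cartesianProduct xs ys)
      ↭⟨ ++⁺ˡ (map (x₀ ,_) (ys ∷ʳ yₗ)) (product-∷ʳ xs ys yₗ) ⟨
    map (x₀ ,_) (ys ∷ʳ yₗ) ++ cartesianProduct xs (ys ∷ʳ yₗ) ∎)
  (((_ , _ , path-++ (path-map right (path-∷ʳ q s)) (left r) (path-map left p) , e) , Qh) ∷ g)
  where open PermutationReasoning

-- Splits off the chain that goes along the first row and then up the last column.
rowColumnTiling : ∀ {N Q} {x₀ xₖ xₘ : Subset b} {y₀ y₁ yₗ : Subset n} {xs ys} →
        Path _⋖_ x₀ xₖ xs → xₖ ⋖ xₘ → y₀ ⋖ y₁ → Path _⋖_ y₁ yₗ ys →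
        Centred N (x₀ , y₀) (xₘ , yₗ) →
        Q (map (_, y₀) (xs ∷ʳ xₘ) ++ map (xₘ ,_) ys) →
        Tiling N Q xs ys → Tiling N Q (xs ∷ʳ xₘ) (y₀ ∷ ys)
rowColumnTiling {Q = Q} {xₘ = xₘ} {y₀} {xs = xs} {ys} p r s q e Qh T =
  swapTiling (columnRowTiling s q p r (centred-swap e) (subst Q (sym eq) Qh)
    (swapTiling (mapTiling (λ {X} _ → subst Q (sym (swap-swap X))) T)))
  where
  eq : map swap (map (y₀ ,_) (xs ∷ʳ xₘ) ++ map (_, xₘ) ys) ≡ map (_, y₀) (xs ∷ʳ xₘ) ++ map (xₘ ,_) ys
  eq = trans (map-++ swap (map (y₀ ,_) (xs ∷ʳ xₘ)) _) (cong₂ _++_ (sym (map-∘ (xs ∷ʳ xₘ))) (sym (map-∘ ys)))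
  swap-swap : ∀ {A B : Set} (X : List (A × B)) → map swap (map swap X) ≡ X
  swap-swap []      = refl
  swap-swap (_ ∷ X) = cong (_ ∷_) (swap-swap X)

-- Tilings whose short chain meets a marked column.

Short : {A : Set} → (A → Set) → List A → Set
Short W X = length X ≤ 2 → Any W X

long⇒Short : {W : A → Set} {X : List A} → 3 ≤ length X → Short W X
long⇒Short l s = ⊥-elim (1+n≰n (≤-trans l s))

length-++-≥ : ∀ {i j} (xs : List A) {ys} → i ≤ length xs → j ≤ length ys → i + j ≤ length (xs ++ ys)
length-++-≥ xs h k = ≤-trans (+-mono-≤ h k) (≤-reflexive (sym (length-++ xs)))

hook-length : ∀ {A B C : Set} {i j} (f : A → C) (g : B → C) us vs → i ≤ length us → j ≤ length vs →
              i + j ≤ length (map f us ++ map g vs)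
hook-length f g us vs h k = length-++-≥ (map f us)
  (≤-trans h (≤-reflexive (sym (length-map f us)))) (≤-trans k (≤-reflexive (sym (length-map g vs))))

module _ {b n : ℕ} (M : Subset b → Set) where

  private
    Short′ : List (Subset b × Subset n) → Set
    Short′ = Short (M ∘ proj₁)

  -- Row-column hooks use up the first row and the last column, so the marked first column survives
  -- until a single row or column is left. A hook is cut only from a grid with at least two rows and
  -- two columns, hence has at least three points.
  cornerTiling : ∀ {N x₀ xₘ y₀ yₗ xs ys} → M x₀ → Path _⋖_ x₀ xₘ xs → Path _⋖_ y₀ yₗ ys →
          Centred N (x₀ , y₀) (xₘ , yₗ) → Tiling N Short′ xs ys
  cornerTiling m p stop e = rowTiling p e (λ _ → Any.map⁺ (Any.map (λ { refl → m }) (first∈ p)))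
  cornerTiling {ys = _ ∷ ys} m p (s ◅ q) e with lastView p
  ... | single = columnTiling (s ◅ q) e (λ _ → here m)
  ... | snoc {a = x₀} {c = xₘ} {xs = xs} p′ r =
    rowColumnTiling p′ r s q e
      (long⇒Short (hook-length _ _ (x₀ ∷ xs ∷ʳ xₘ) ys
        (length-++-≥ (x₀ ∷ xs) (path-length p′) (s≤s z≤n)) (path-length q)))
      (cornerTiling m p′ q (centred-rowColumn e r s))

  -- Hooks are split off on the side of xs away from the mark, so the mark survives to the innermost chain,
  -- which is the only one that can be short.
  markedTiling : ∀ {N x₀ xₘ y₀ yₗ xs ys} → Path _⋖_ x₀ xₘ xs → Any M xs → Path _⋖_ y₀ yₗ ys →
         Centred N (x₀ , y₀) (xₘ , yₗ) → Tiling N Short′ xs ys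
  markedTiling p@stop    (here m)  q e = cornerTiling m p q e
  markedTiling p@(_ ◅ _) (here m)  q e = cornerTiling m p q e
  markedTiling {xs = _ ∷ xs} (r ◅ p) (there m) q e with lastView q
  ... | single = rowTiling (r ◅ p) e (λ _ → Any.map⁺ (there m))
  ... | snoc {a = y₀} {c = yₗ} {xs = ys} q′ s =
    columnRowTiling r p q′ s e
      (long⇒Short (hook-length _ _ (y₀ ∷ ys ∷ʳ yₗ) xs
        (length-++-≥ (y₀ ∷ ys) (path-length q′) (s≤s z≤n)) (path-length p)))
      (markedTiling p m q′ (centred-columnRow e r s))

-- Grids in which one side may be a full chain.

∈-row⁻ : ∀ {x : A} {y y′ : B} {xs} → (x , y) ∈ map (_, y′) xs → x ∈ xs × y ≡ y′
∈-row⁻ m with ∈-map⁻ _ m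
... | _ , k , refl = k , refl

∈-column⁻ : ∀ {x x′ : A} {y : B} {ys} → (x , y) ∈ map (x′ ,_) ys → x ≡ x′ × y ∈ ys
∈-column⁻ m with ∈-map⁻ _ m
... | _ , k , refl = refl , k

∈-swap⁻ : ∀ {x : A} {y : B} {X} → (x , y) ∈ map swap X → (y , x) ∈ X
∈-swap⁻ m with ∈-map⁻ swap m
... | _ , k , refl = k

length-∷ʳ : ∀ (xs : List A) {x} → length (xs ∷ʳ x) ≡ suc (length xs)
length-∷ʳ xs = trans (length-++ xs) (+-comm (length xs) 1)

Short-swap : ∀ {A B : Set} {W : A → Set} {X : List (A × B)} →
             Short (W ∘ proj₁) X → Short (W ∘ proj₂) (map swap X)
Short-swap {X = X} sh h = Any.map⁺ (sh (subst (_≤ 2) (length-map swap X) h))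

Short-swap⁻ : ∀ {A B : Set} {W : A → Set} {X : List (B × A)} →
              Short (W ∘ proj₂) X → Short (W ∘ proj₁) (map swap X)
Short-swap⁻ {X = X} sh h = Any.map⁺ (sh (subst (_≤ 2) (length-map swap X) h))

-- Some chain has to join the two ends of a row, and it is made to do so in a labelled one. If the
-- upper row is labelled, a column-row hook takes it whole and the lower row is left without its
-- first point; if the lower row is labelled, a row-column hook takes it and the upper row is left
-- without its last point. Both chains have at least three points.
twoRowTiling : ∀ {L : Subset n → Set} {N} {x₀ x₁ xₘ : Subset b} {xs y₀ y₁} →
          x₀ ⋖ x₁ → Path _⋖_ x₁ xₘ xs → 3 ≤ length xs → y₀ ⋖ y₁ → L y₀ ⊎ L y₁ →
          Centred N (x₀ , y₀) (xₘ , y₁) →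
          Tiling N (λ X → 3 ≤ length X × (∀ {y} → (x₀ , y) ∈ X → (xₘ , y) ∈ X → L y))
                 (x₀ ∷ xs) (y₀ ∷ y₁ ∷ [])
twoRowTiling {L = L} {x₀ = x₀} {xₘ = xₘ} {xs} {y₀} {y₁} r p h s (inj₂ l₁) e =
  columnRowTiling r p stop s e (s≤s (s≤s (≤-trans (s≤s z≤n) h′)) , λ _ → rows)
    (rowTiling p (centred-columnRow e r s)
      (≤-trans h (≤-reflexive (sym (length-map _ xs))) , λ m _ → ⊥-elim (before-∉ r p (proj₁ (∈-row⁻ m)))))
  where
  h′ : 3 ≤ length (map (_, y₁) xs)
  h′ = ≤-trans h (≤-reflexive (sym (length-map _ xs)))
  rows : ∀ {y} → (xₘ , y) ∈ (x₀ , y₀) ∷ (x₀ , y₁) ∷ map (_, y₁) xs → L y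
  rows (here refl)         = ⊥-elim (before-∉ r p (last∈ p))
  rows (there (here refl)) = l₁
  rows (there (there m)) with ∈-row⁻ m
  ... | _ , refl = l₁
twoRowTiling {L = L} {x₀ = x₀} {xₘ = xₘ} {y₀ = y₀} {y₁} r p h s (inj₁ l₀) e with unsnoc r p
... | _ , us , q , t , refl =
  rowColumnTiling q t s stop e
    (≤-trans (s≤s (s≤s (s≤s z≤n)))
      (hook-length (_, y₀) (xₘ ,_) (x₀ ∷ us ∷ʳ xₘ) (y₁ ∷ []) (≤-trans h (n≤1+n _)) (s≤s z≤n)) , λ m _ → rows m)
    (rowTiling q (centred-rowColumn e t s)
      (≤-trans h (≤-reflexive (trans (length-∷ʳ us) (sym (length-map _ (x₀ ∷ us))))) ,
       λ _ m → ⊥-elim (after-∉ q t (proj₁ (∈-row⁻ m)))))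
  where
  rows : ∀ {y} → (x₀ , y) ∈ map (_, y₀) (x₀ ∷ us ∷ʳ xₘ) ++ (xₘ , y₁) ∷ [] → L y
  rows m with ∈-++⁻ (map (_, y₀) (x₀ ∷ us ∷ʳ xₘ)) m
  ... | inj₂ (here refl) = ⊥-elim (before-∉ r p (last∈ p))
  ... | inj₁ k with ∈-row⁻ k
  ...   | _ , refl = l₀

record Interior {A B : Set} (W : A × B → Set) (x₀ xₘ : A) (y₀ yₗ : B) (X : List (A × B)) : Set where
  constructor interior
  field
    short    : Short W X
    noRow    : ∀ {y} → (x₀ , y) ∈ X → (xₘ , y) ∉ X
    noColumn : ∀ {x} → (x , y₀) ∈ X → (x , yₗ) ∉ X
open Interior

-- Two column-row hooks are split off and exchange their tails: the outer hook gives its two ends (x₀ , y₀)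
-- and (xₘ , yₗ) to the inner one. Neither resulting chain joins the two ends of a row or of a column.
exchangeTiling : ∀ {N W} {x₀ x₁ x₂ xₘ : Subset b} {y₀ y₁ yⱼ yₖ yₗ : Subset n} {xs ys zs} →
         x₀ ⋖ x₁ → x₁ ⋖ x₂ → Path _⋖_ x₂ xₘ xs →
         y₀ ⋖ y₁ → Path _⋖_ y₁ yₗ ys →
         Path _⋖_ y₀ yⱼ (y₀ ∷ zs) → yⱼ ⋖ yₖ → yₖ ⋖ yₗ → ys ≡ (zs ∷ʳ yₖ) ∷ʳ yₗ →
         Centred N (x₀ , y₀) (xₘ , yₗ) →
         Tiling N (Short W) xs (y₀ ∷ zs) →
         Tiling N (Interior W x₀ xₘ y₀ yₗ) (x₀ ∷ x₁ ∷ xs) (y₀ ∷ ys)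
exchangeTiling {N = N} {W} {x₀} {x₁} {x₂} {xₘ} {y₀} {y₁} {yⱼ} {yₖ} {yₗ} {_} {_} {zs} r₀ r₁ p s₀ q q′ s₁ s₂ refl e T
  with unsnoc r₁ p
... | xⱼ , us , p′ , r₂ , refl = tiling (long ∷ other ∷ Tiling.chains T) covers
    (((_ , _ , longPath , e) , interior (long⇒Short longLength) longRow longColumn) ∷
     ((_ , _ , otherPath , centred-rowColumn e r₂ s₀) , interior (long⇒Short otherLength) otherRow otherColumn) ∷
     Tiling.good (mapTiling restInterior T))
  where
  xs = us ∷ʳ xₘ
  ys = (zs ∷ʳ yₖ) ∷ʳ yₗ
  hook long other : List (Subset _ × Subset _)
  hook  = map (x₁ ,_) (y₀ ∷ zs ∷ʳ yₖ) ++ map (_, yₖ) xs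
  long  = (x₀ , y₀) ∷ (hook ∷ʳ (xₘ , yₗ))
  other = map (x₀ ,_) ys ++ map (_, yₗ) (x₁ ∷ us)

  longPath : Path _⋖₂_ (x₀ , y₀) (xₘ , yₗ) long
  longPath = left r₀ ◅ path-∷ʳ (path-++ (path-map right (path-∷ʳ q′ s₁)) (left r₁) (path-map left p)) (right s₂)

  otherPath : Path _⋖₂_ (x₀ , y₁) (xⱼ , yₗ) other
  otherPath = path-++ (path-map right q) (left r₀) (path-map left p′)

  longLength : 3 ≤ length long
  longLength = s≤s (≤-trans (s≤s (s≤s z≤n)) (length-++-≥ {i = 1} hook (s≤s z≤n) (s≤s z≤n)))

  otherLength : 3 ≤ length other
  otherLength = hook-length _ _ ys (x₁ ∷ us) (≤-trans (s≤s (s≤s z≤n))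
    (length-++-≥ {j = 1} (zs ∷ʳ yₖ) (≤-trans (s≤s z≤n) (≤-reflexive (sym (length-∷ʳ zs)))) (s≤s z≤n))) (s≤s z≤n)

  x₀∉ : x₀ ∉ x₁ ∷ xs
  x₀∉ = before-∉ r₀ (r₁ ◅ p)
  xₘ∉ : xₘ ∉ x₁ ∷ us
  xₘ∉ = after-∉ p′ r₂
  xₘ∈ : xₘ ∈ x₁ ∷ xs
  xₘ∈ = there (last∈ p)
  y₀∉ : y₀ ∉ ys
  y₀∉ = before-∉ s₀ q
  yₗ∉ : yₗ ∉ y₀ ∷ zs ∷ʳ yₖ
  yₗ∉ = after-∉ (path-∷ʳ q′ s₁) s₂
  yₖ∈ : yₖ ∈ zs ∷ʳ yₖ
  yₖ∈ = ∈-++⁺ʳ zs (here refl)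

  ∈-long⁻ : ∀ {x y} → (x , y) ∈ long →
            (x ≡ x₀ × y ≡ y₀) ⊎ (x ≡ x₁ × y ∈ y₀ ∷ zs ∷ʳ yₖ) ⊎ (x ∈ xs × y ≡ yₖ) ⊎ (x ≡ xₘ × y ≡ yₗ)
  ∈-long⁻ (here refl) = inj₁ (refl , refl)
  ∈-long⁻ (there m) with ∈-++⁻ hook m
  ... | inj₂ (here refl) = inj₂ (inj₂ (inj₂ (refl , refl)))
  ... | inj₁ k with ∈-++⁻ (map (x₁ ,_) (y₀ ∷ zs ∷ʳ yₖ)) k
  ...   | inj₁ i = inj₂ (inj₁ (∈-column⁻ i))
  ...   | inj₂ i = inj₂ (inj₂ (inj₁ (∈-row⁻ i)))

  -- `long` meets the first column only in `(x₀ , y₀)` and the last row only in `(xₘ , yₗ)`, so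
  -- joining the ends of a row or a column would force it through this corner.
  corner∉ : (xₘ , y₀) ∉ long
  corner∉ m with ∈-long⁻ m
  ... | inj₁ (refl , _)                  = x₀∉ xₘ∈
  ... | inj₂ (inj₁ (refl , _))           = xₘ∉ (here refl)
  ... | inj₂ (inj₂ (inj₁ (_ , refl)))    = y₀∉ (∈-++⁺ˡ yₖ∈)
  ... | inj₂ (inj₂ (inj₂ (_ , refl)))    = yₗ∉ (here refl)

  longRow : ∀ {y} → (x₀ , y) ∈ long → (xₘ , y) ∉ long
  longRow m k with ∈-long⁻ m
  ... | inj₁ (_ , refl)                  = corner∉ k
  ... | inj₂ (inj₁ (refl , _))           = x₀∉ (here refl)
  ... | inj₂ (inj₂ (inj₁ (i , _)))       = x₀∉ (there i)
  ... | inj₂ (inj₂ (inj₂ (refl , _)))    = x₀∉ xₘ∈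

  longColumn : ∀ {x} → (x , y₀) ∈ long → (x , yₗ) ∉ long
  longColumn m k with ∈-long⁻ k
  ... | inj₁ (_ , refl)                  = yₗ∉ (here refl)
  ... | inj₂ (inj₁ (_ , i))              = yₗ∉ i
  ... | inj₂ (inj₂ (inj₁ (_ , refl)))    = yₗ∉ (there yₖ∈)
  ... | inj₂ (inj₂ (inj₂ (refl , _)))    = corner∉ m

  -- `other` avoids the last column and the first row altogether.
  otherRow : ∀ {y} → (x₀ , y) ∈ other → (xₘ , y) ∉ other
  otherRow _ k with ∈-++⁻ (map (x₀ ,_) ys) k
  ... | inj₁ i = x₀∉ (subst (_∈ x₁ ∷ xs) (proj₁ (∈-column⁻ i)) xₘ∈)
  ... | inj₂ i = xₘ∉ (proj₁ (∈-row⁻ i))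

  otherColumn : ∀ {x} → (x , y₀) ∈ other → (x , yₗ) ∉ other
  otherColumn m _ with ∈-++⁻ (map (x₀ ,_) ys) m
  ... | inj₁ i = y₀∉ (proj₂ (∈-column⁻ i))
  ... | inj₂ i = yₗ∉ (here (sym (proj₂ (∈-row⁻ i))))

  -- The remaining chains avoid the first column and the last row.
  restInterior : ∀ {X} → (∀ {x y} → (x , y) ∈ X → x ∈ xs × y ∈ y₀ ∷ zs) → Short W X → Interior W x₀ xₘ y₀ yₗ X
  restInterior sub sh = interior sh (λ m _ → x₀∉ (there (proj₁ (sub m)))) (λ _ k → yₗ∉ (∈-++⁺ˡ (proj₂ (sub k))))

  covers : long ++ other ++ concat (Tiling.chains T) ↭ cartesianProduct (x₀ ∷ x₁ ∷ xs) (y₀ ∷ ys)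
  covers = begin
    a ++ (((b′ ++ c) ++ d) ++ ((f ++ (g ++ h)) ++ concat (Tiling.chains T)))
      ↭⟨ ++⁺ˡ a (++⁺ˡ ((b′ ++ c) ++ d) (++⁺ˡ (f ++ (g ++ h)) (Tiling.tiles T))) ⟩
    a ++ (((b′ ++ c) ++ d) ++ ((f ++ (g ++ h)) ++ k))
      -- The pieces are regrouped as column `x₀`, column `x₁`, the part of the last row over `xs`,
      -- and what lies over `xs` below it.
      ↭⟨ ++-solve 8 (λ a b c d f g h k →
           (a ⊕ (((b ⊕ c) ⊕ d) ⊕ ((f ⊕ (g ⊕ h)) ⊕ k))) ⊜ ((a ⊕ f) ⊕ ((b ⊕ g) ⊕ ((h ⊕ d) ⊕ (c ⊕ k)))))
           ↭-refl a b′ c d f g h k ⟩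
    (a ++ f) ++ ((b′ ++ g) ++ ((h ++ d) ++ (c ++ k)))
      ↭⟨ ++⁺ˡ (a ++ f) (++⁺ (↭-reflexive (sym (map-++ (x₁ ,_) (y₀ ∷ zs ∷ʳ yₖ) (yₗ ∷ []))))
           (++⁺ (↭-reflexive (sym (map-++ (_, yₗ) us (xₘ ∷ [])))) (↭-sym (product-∷ʳ xs (y₀ ∷ zs) yₖ)))) ⟩
    map (x₀ ,_) (y₀ ∷ ys) ++ (map (x₁ ,_) (y₀ ∷ ys) ++ (map (_, yₗ) xs ++ cartesianProduct xs (y₀ ∷ zs ∷ʳ yₖ)))
      ↭⟨ ++⁺ˡ (a ++ f) (++⁺ˡ (map (x₁ ,_) (y₀ ∷ ys)) (product-∷ʳ xs (y₀ ∷ zs ∷ʳ yₖ) yₗ)) ⟨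
    cartesianProduct (x₀ ∷ x₁ ∷ xs) (y₀ ∷ ys) ∎
    where
    open PermutationReasoning
    a = (x₀ , y₀) ∷ []
    b′ = map (x₁ ,_) (y₀ ∷ zs ∷ʳ yₖ)
    c = map (_, yₖ) xs
    d = (xₘ , yₗ) ∷ []
    f = map (x₀ ,_) ys
    g = (x₁ , yₗ) ∷ []
    h = map (_, yₗ) us
    k = cartesianProduct xs (y₀ ∷ zs)

-- A full chain of Q_k has k + 1 members, so the bounds 4 ≤ length restrict row and column to the grids
-- in which the chain xs, respectively ys, may be full.
record GridChain {b n : ℕ} (M : Subset b → Set) (L : Subset n → Set) (xs : List (Subset b)) (ys : List (Subset n))
                 (x₀ xₘ : Subset b) (y₀ yₗ : Subset n) (X : List (Subset b × Subset n)) : Set where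
  constructor gridChain
  field
    short  : Short (M ∘ proj₁) X
    row    : 4 ≤ length xs → ∀ {y} → (x₀ , y) ∈ X → (xₘ , y) ∈ X → L y
    column : 4 ≤ length ys → ∀ {x} → (x , y₀) ∈ X → (x , yₗ) ∈ X → M x

private
  3≰2 : ∀ {A : Set} {k} → suc (suc (suc k)) ≤ 2 → A
  3≰2 (s≤s (s≤s ()))

-- The cases go by the size of the grid, since `row` is a condition only from four columns on and
-- `column` only from four rows on. With two columns, fewer than four rows leave just the marks to
-- respect, and more rows call for the transposed two-row tiling with marks as labels. With four or
-- more columns, a single row is one chain over a labelled set, two rows are tiled by
-- `twoRowTiling`, and three or more by `exchangeTiling`.
gridTiling : ∀ {N} {M : Subset b → Set} {L : Subset n → Set} {x₀ xₘ xs y₀ yₗ ys} →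
       Path _⋖_ x₀ xₘ xs → Any M xs → length xs ≡ 2 ⊎ 4 ≤ length xs →
       Path _⋖_ y₀ yₗ ys → (length ys ≤ 2 → Any L ys) →
       Centred N (x₀ , y₀) (xₘ , yₗ) →
       Tiling N (GridChain M L xs ys x₀ xₘ y₀ yₗ) xs ys
gridTiling stop m (inj₁ ()) q l e
gridTiling stop m (inj₂ (s≤s ())) q l e
gridTiling (_ ◅ _ ◅ stop) m (inj₁ ()) q l e
gridTiling (_ ◅ _ ◅ stop) m (inj₂ (s≤s (s≤s (s≤s ())))) q l e
gridTiling {ys = ys} (r ◅ stop) m _ q l e with 4 ≤? length ys
... | no h = mapTiling (λ _ sh → gridChain sh (λ h′ → 3≰2 h′) (λ h′ → ⊥-elim (h h′))) (markedTiling _ (r ◅ stop) m q e)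
gridTiling (r ◅ stop) m _ stop l e | yes (s≤s ())
gridTiling {M = M} {L} {x₀} {xₘ} {y₀ = y₀} {yₗ} (r ◅ stop) m _ (s ◅ q) l e | yes (s≤s h) =
  swapTiling (mapTiling (λ {X} _ (h′ , col) → gridChain
      (long⇒Short (≤-trans h′ (≤-reflexive (sym (length-map swap X))))) (λ h″ → 3≰2 h″)
      (λ _ i j → col (∈-swap⁻ i) (∈-swap⁻ j)))
    (twoRowTiling {L = M} s q h r (endpoint m) (centred-swap e)))
  where
  endpoint : ∀ {x x′} → Any M (x ∷ x′ ∷ []) → M x ⊎ M x′
  endpoint (here m)         = inj₁ m
  endpoint (there (here m)) = inj₂ m
gridTiling {L = L} p@(_ ◅ _ ◅ _ ◅ _) m _ (stop {y}) l e = rowTiling p e (gridChain (λ _ → Any.map⁺ m)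
  (λ _ i _ → subst L (sym (proj₂ (∈-row⁻ i))) (only (l (s≤s z≤n)))) (λ { (s≤s ()) }))
  where
  only : ∀ {y} → Any L (y ∷ []) → L y
  only (here k) = k
gridTiling {L = L} (r ◅ p@(_ ◅ _ ◅ p′)) m _ (s ◅ stop) l e =
  mapTiling (λ _ (h , row) → gridChain (long⇒Short h) (λ _ → row) (λ h′ → 3≰2 h′))
    (twoRowTiling r p (s≤s (s≤s (path-length p′))) s (endpoint (l ≤-refl)) e)
  where
  endpoint : ∀ {y y′} → Any L (y ∷ y′ ∷ []) → L y ⊎ L y′
  endpoint (here k)         = inj₁ k
  endpoint (there (here k)) = inj₂ k
-- The exchange gives up the columns `x₀` and `x₁`, and the rest goes to `markedTiling`; this works
-- if there is a mark beyond these two.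
gridTiling {b = b} {M = M} (r₀ ◅ r₁ ◅ r₂ ◅ p) m _ (s₀ ◅ s₁ ◅ q) l e with Any.++⁻ (_ ∷ _ ∷ []) m
... | inj₂ m′ with unsnoc₂ s₀ s₁ q
...   | _ , _ , _ , q′ , t₁ , t₂ , eq =
  mapTiling (λ _ i → gridChain (short i) (λ _ j k → ⊥-elim (noRow i j k)) (λ _ j k → ⊥-elim (noColumn i j k)))
    (exchangeTiling r₀ r₁ (r₂ ◅ p) s₀ (s₁ ◅ q) q′ t₁ t₂ eq e
      (markedTiling M (r₂ ◅ p) m′ q′ (centred-columnRow (centred-columnRow e r₀ t₂) r₁ t₁)))
-- If the mark is on `x₀` or `x₁`, the transposed exchange gives up the last two columns instead;
-- among at least four columns the first two survive, as `front` shows.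
gridTiling {b = b} {M = M} (r₀ ◅ r₁ ◅ r₂ ◅ p) m _ (s₀ ◅ s₁ ◅ q) l e | inj₁ m′ with unsnoc₂ r₀ r₁ (r₂ ◅ p)
... | _ , _ , us , p′ , t₁ , t₂ , eq =
  swapTiling (mapTiling (λ _ i → gridChain (Short-swap⁻ (short i))
      (λ _ j k → ⊥-elim (noColumn i (∈-swap⁻ j) (∈-swap⁻ k)))
      (λ _ j k → ⊥-elim (noRow i (∈-swap⁻ j) (∈-swap⁻ k))))
    (exchangeTiling s₀ s₁ q r₀ (r₁ ◅ r₂ ◅ p) p′ t₁ t₂ eq (centred-swap e)
      (swapTiling (mapTiling (λ _ → Short-swap) (markedTiling M p′ (front p′ eq (path-length p) m′) q
        (centred-rowColumn (centred-rowColumn e t₂ s₀) t₁ s₁))))))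
  where
  front : ∀ {x₀ x₁ x₂ xⱼ xₖ xₘ : Subset b} {us xs} → Path _⋖_ x₀ xⱼ (x₀ ∷ us) →
          x₁ ∷ x₂ ∷ xs ≡ (us ∷ʳ xₖ) ∷ʳ xₘ → 1 ≤ length xs → Any M (x₀ ∷ x₁ ∷ []) → Any M (x₀ ∷ us)
  front p          eq   h  (here m)         = here m
  front stop       refl () (there (here m))
  front (t ◅ stop) eq h    (there (here m)) = there (here (subst M (∷-injectiveˡ eq) m))
  front (t ◅ _ ◅ _) eq h   (there (here m)) = there (here (subst M (∷-injectiveˡ eq) m))

-- Full chains, decompositions and orthogonality.

module Inclusion {n} = Order {R = _⋖_ {n}} {_≼_ = _⊆_}
  (λ {S} → ⊆-refl {x = S}) (λ {S} {T} {U} → ⊆-trans {i = S} {T} {U}) ⋖⇒⊆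

path-size : ∀ {S T : Subset n} {C} → Path _⋖_ S T C → length C + ∣ S ∣ ≡ suc ∣ T ∣
path-size stop = refl
path-size {C = _ ∷ C} (r ◅ p) =
  trans (sym (+-suc (length C) _)) (trans (cong (length C +_) (sym (size r))) (path-size p))

starts-⊥ : ∀ {S T : Subset n} {C} → Path _⋖_ S T C → ⊥ ∈ C → S ≡ ⊥
starts-⊥ p m = ⊆-antisym (Inclusion.first-≼ p m) ⊥⊆

ends-⊤ : ∀ {S T : Subset n} {C} → Path _⋖_ S T C → ⊤ ∈ C → T ≡ ⊤
ends-⊤ p m = ⊆-antisym ⊆⊤ (Inclusion.≼-last p m)

full-length : ∀ {S T : Subset n} {C} → Path _⋖_ S T C → ⊥ ∈ C → ⊤ ∈ C → length C ≡ suc n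
full-length {n} {C = C} p m k with starts-⊥ p m | ends-⊤ p k
... | refl | refl = begin
  length C                ≡⟨ +-identityʳ _ ⟨
  length C + 0            ≡⟨ cong (length C +_) (∣⊥∣≡0 n) ⟨
  length C + ∣ ⊥ {n} ∣    ≡⟨ path-size p ⟩
  suc ∣ ⊤ {n} ∣           ≡⟨ cong suc (∣⊤∣≡n n) ⟩
  suc n                   ∎
  where open ≡-Reasoning

record Decomposition {n : ℕ} (F : List (List (Subset n))) : Set where
  field
    symmetric : All SymmetricChain F
    unique    : Unique (concat F)
    complete  : ∀ S → S ∈ concat F

EqualOrExtreme : Subset n → Subset n → Set
EqualOrExtreme S T = S ≡ T ⊎ (S ≡ ⊥ × T ≡ ⊤) ⊎ (S ≡ ⊤ × T ≡ ⊥)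

-- Almost orthogonality phrased through two shared points instead of a count, so that it can be
-- applied to each coordinate of a product separately.
Orthogonal : {n : ℕ} → List (List (Subset n)) → List (List (Subset n)) → Set
Orthogonal F G = ∀ {A B S T} → A ∈ F → B ∈ G → S ∈ A → T ∈ A → S ∈ B → T ∈ B →
                 EqualOrExtreme S T

-- The endpoints of the grid give way to `⊥` and `⊤`, the only sets that two shared points can
-- exchange. `D` and `C` are kept in order to apply orthogonality in the factors.
record PairChain {b n : ℕ} (M : Subset b → Set) (L : Subset n → Set)
                 (G : List (List (Subset b))) (F : List (List (Subset n)))
                 (X : List (Subset b × Subset n)) : Set where
  field
    {D}       : List (Subset b)
    {C}       : List (Subset n)
    D∈        : D ∈ G
    C∈        : C ∈ F
    within    : ∀ {x y} → (x , y) ∈ X → x ∈ D × y ∈ C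
    symmetric : SymmetricChain₂ (b + n) X
    short     : Short (M ∘ proj₁) X
    row       : ∀ {y} → (⊥ , y) ∈ X → (⊤ , y) ∈ X → L y
    column    : ∀ {x} → (x , ⊥) ∈ X → (x , ⊤) ∈ X → M x

-- Assembling the grid tilings over all pairs of chains.

module Product {b n : ℕ} (3≤b : 3 ≤ b) (3≤n : 3 ≤ n) {M : Subset b → Set} {L : Subset n → Set}
               {G : List (List (Subset b))} {F : List (List (Subset n))}
               (G-symmetric : All SymmetricChain G) (G-marked : All (Any M) G)
               (G-lengths : All (λ D → length D ≡ 2 ⊎ 4 ≤ length D) G)
               (F-symmetric : All SymmetricChain F) (F-short : All (Short L) F) where

  pairTiling : ∀ {D C} → D ∈ G → C ∈ F → Tiling (b + n) (PairChain M L G F) D C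
  pairTiling {D} {C} D∈ C∈ with All.lookup G-symmetric D∈ | All.lookup F-symmetric C∈
  ... | x₀ , xₘ , p , ep | y₀ , yₗ , q , eq =
    tiling (Tiling.chains T) (Tiling.tiles T) (All.tabulate λ X∈ →
      let c , g = All.lookup (Tiling.good T) X∈ in c ,
      toPair (∈-cartesianProduct⁻ _ _ ∘ ∈-resp-↭ (Tiling.tiles T) ∘ λ m → ∈-concat⁺′ m X∈) c g)
    where
    e : Centred (b + n) (x₀ , y₀) (xₘ , yₗ)
    e = centred (trans (+-interchange (∣ x₀ ∣) (∣ y₀ ∣) (∣ xₘ ∣) (∣ yₗ ∣)) (cong₂ _+_ ep eq))

    T : Tiling (b + n) (GridChain M L D C x₀ xₘ y₀ yₗ) D C
    T = gridTiling p (All.lookup G-marked D∈) (All.lookup G-lengths D∈) q (All.lookup F-short C∈) e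

    toPair : ∀ {X} → (∀ {x y} → (x , y) ∈ X → x ∈ D × y ∈ C) → SymmetricChain₂ (b + n) X →
             GridChain M L D C x₀ xₘ y₀ yₗ X → PairChain M L G F X
    toPair {X} sub c g = record
      { D∈ = D∈ ; C∈ = C∈ ; within = sub ; symmetric = c ; short = GridChain.short g ; row = row ; column = column }
      where
      row : ∀ {y} → (⊥ , y) ∈ X → (⊤ , y) ∈ X → L y
      row m k with starts-⊥ p (proj₁ (sub m)) | ends-⊤ p (proj₁ (sub k))
                | full-length p (proj₁ (sub m)) (proj₁ (sub k))
      ... | refl | refl | l = GridChain.row g (≤-trans (s≤s 3≤b) (≤-reflexive (sym l))) m k

      column : ∀ {x} → (x , ⊥) ∈ X → (x , ⊤) ∈ X → M x
      column m k with starts-⊥ q (proj₂ (sub m)) | ends-⊤ q (proj₂ (sub k))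
                | full-length q (proj₂ (sub m)) (proj₂ (sub k))
      ... | refl | refl | l = GridChain.column g (≤-trans (s≤s 3≤n) (≤-reflexive (sym l))) m k

  Pairs : List (Subset b) → List (Subset n) → Set
  Pairs = Tiling (b + n) (PairChain M L G F)

  stripTiling : ∀ {D Cs} → D ∈ G → All (_∈ F) Cs → Pairs D (concat Cs)
  stripTiling {D} D∈ [] = tiling [] (↭-reflexive (sym (cartesianProductWith-zeroʳ _,_ D))) []
  stripTiling {D} {C ∷ Cs} D∈ (C∈ ∷ Cs∈) with pairTiling D∈ C∈ | stripTiling D∈ Cs∈
  ... | tiling H t g | tiling H′ t′ g′ = tiling (H ++ H′) (begin
      concat (H ++ H′)                                          ≡⟨ concat-++ H H′ ⟨
      concat H ++ concat H′                                     ↭⟨ ++⁺ t t′ ⟩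
      cartesianProduct D C ++ cartesianProduct D (concat Cs)    ↭⟨ product-++ʳ D C (concat Cs) ⟨
      cartesianProduct D (C ++ concat Cs)                       ∎)
    (All.++⁺ g g′)
    where open PermutationReasoning

  productTiling : ∀ {Ds} → All (_∈ G) Ds → Pairs (concat Ds) (concat F)
  productTiling [] = tiling [] ↭-refl []
  productTiling {D ∷ Ds} (D∈ ∷ Ds∈) with stripTiling D∈ (All.tabulate id) | productTiling Ds∈
  ... | tiling H t g | tiling H′ t′ g′ = tiling (H ++ H′) (begin
      concat (H ++ H′)                                                    ≡⟨ concat-++ H H′ ⟨
      concat H ++ concat H′                                               ↭⟨ ++⁺ t t′ ⟩
      cartesianProduct D (concat F) ++ cartesianProduct (concat Ds) (concat F)
        ≡⟨ cartesianProductWith-distribʳ-++ _,_ D (concat Ds) (concat F) ⟨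
      cartesianProduct (D ++ concat Ds) (concat F)                        ∎)
    (All.++⁺ g g′)
    where open PermutationReasoning

-- Passing from pairs of sets to sets.

join : Subset b × Subset n → Subset (b + n)
join (S , T) = S Vec.++ T

join-injective : {s t : Subset b × Subset n} → join s ≡ join t → s ≡ t
join-injective {s = S , T} {S′ , T′} e with Vec.++-injective S S′ e
... | refl , refl = refl

∣join∣ : (s : Subset b × Subset n) → ∣ join s ∣ ≡ size₂ s
∣join∣ (Vec.[] , T) = refl
∣join∣ (outside Vec.∷ S , T) = ∣join∣ (S , T)
∣join∣ (inside Vec.∷ S , T) = cong suc (∣join∣ (S , T))

++⁺-⊆ : ∀ {S S′ : Subset b} (T : Subset n) → S ⊆ S′ → S Vec.++ T ⊆ S′ Vec.++ T
++⁺-⊆ {S = Vec.[]}          {Vec.[]}          T h = id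
++⁺-⊆ {S = outside Vec.∷ S} {_ Vec.∷ S′}       T h = out⊆ (++⁺-⊆ T (drop-∷-⊆ h))
++⁺-⊆ {S = inside Vec.∷ S}  {inside Vec.∷ S′}  T h = in⊆in (++⁺-⊆ T (drop-∷-⊆ h))
++⁺-⊆ {S = inside Vec.∷ S}  {outside Vec.∷ S′} T h with h Vec.here
... | ()

++⁺ʳ-⊆ : ∀ (S : Subset b) {T T′ : Subset n} → T ⊆ T′ → S Vec.++ T ⊆ S Vec.++ T′
++⁺ʳ-⊆ Vec.[]            h = h
++⁺ʳ-⊆ (outside Vec.∷ S) h = out⊆ (++⁺ʳ-⊆ S h)
++⁺ʳ-⊆ (inside Vec.∷ S)  h = in⊆in (++⁺ʳ-⊆ S h)

join-⋖ : {s t : Subset b × Subset n} → s ⋖₂ t → join s ⋖ join t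
join-⋖ {s = s} {t} (left {S} {S′} {T} r) = cover (++⁺-⊆ T (⋖⇒⊆ r))
  (trans (∣join∣ t) (trans (cong (_+ ∣ T ∣) (size r)) (cong suc (sym (∣join∣ s)))))
join-⋖ {s = s} {t} (right {S} {T} {T′} r) = cover (++⁺ʳ-⊆ S (⋖⇒⊆ r))
  (trans (∣join∣ t) (trans (cong (∣ S ∣ +_) (size r)) (trans (+-suc _ _) (cong suc (sym (∣join∣ s))))))

join-⊥ : ∀ b → join (⊥ {b} , ⊥ {n}) ≡ ⊥
join-⊥ zero    = refl
join-⊥ (suc b) = cong (_ Vec.∷_) (join-⊥ b)

join-⊤ : ∀ b → join (⊤ {b} , ⊤ {n}) ≡ ⊤
join-⊤ zero    = refl
join-⊤ (suc b) = cong (_ Vec.∷_) (join-⊤ b)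

_≤₂_ : Subset b × Subset n → Subset b × Subset n → Set
(S , T) ≤₂ (S′ , T′) = ∣ S ∣ ≤ ∣ S′ ∣ × ∣ T ∣ ≤ ∣ T′ ∣

≤₂-trans : {s t u : Subset b × Subset n} → s ≤₂ t → t ≤₂ u → s ≤₂ u
≤₂-trans (h , k) (h′ , k′) = ≤-trans h h′ , ≤-trans k k′

⋖₂-≤₂ : {s t : Subset b × Subset n} → s ⋖₂ t → s ≤₂ t
⋖₂-≤₂ (left r)  = ⋖-≤ r , ≤-refl
⋖₂-≤₂ (right r) = ≤-refl , ⋖-≤ r

module Size₂ {b n} = Order {R = _⋖₂_ {b} {n}} {_≼_ = _≤₂_} (≤-refl , ≤-refl)
  (λ {s} {t} {u} → ≤₂-trans {s = s} {t} {u}) ⋖₂-≤₂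

⊤≰⊥ : 3 ≤ n → ¬ (∣ ⊤ {n} ∣ ≤ ∣ ⊥ {n} ∣)
⊤≰⊥ {n} h k = 1+n≰n (≤-trans (s≤s z≤n) (≤-trans h (subst₂ _≤_ (∣⊤∣≡n n) (∣⊥∣≡0 n) k)))

-- Along a chain neither coordinate ever decreases in size, while these two corners are ordered
-- oppositely in the two coordinates.
corners-incomparable : ∀ {N} {X : List (Subset b × Subset n)} → 3 ≤ b → 3 ≤ n → SymmetricChain₂ N X →
                       (⊥ , ⊤) ∈ X → (⊤ , ⊥) ∉ X
corners-incomparable 3≤b 3≤n (_ , _ , p , _) m k with Size₂.comparable p m k
... | inj₁ (_ , h) = ⊤≰⊥ 3≤n h
... | inj₂ (h , _) = ⊤≰⊥ 3≤b h

-- Labelled families and their products.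

record Family (n : ℕ) : Set₁ where
  field
    F             : Fin 3 → List (List (Subset n))
    L             : Fin 3 → Subset n → Set
    decomposition : ∀ i → Decomposition (F i)
    short         : ∀ i → All (Short (L i)) (F i)
    disjoint      : ∀ {i j} → i ≢ j → ∀ {S} → L i S → ¬ L j S
    orthogonal    : ∀ {i j} → i ≢ j → Orthogonal (F i) (F j)

-- The labels of the family double as the marks. For odd `b`, as with 5 and 7, a symmetric chain has
-- an even number of members, which gives `lengths`.
record Base (b : ℕ) : Set₁ where
  field
    family  : Family b
    marked  : ∀ i → All (Any (Family.L family i)) (Family.F family i)
    lengths : ∀ i → All (λ D → length D ≡ 2 ⊎ 4 ≤ length D) (Family.F family i)

module _ {b n : ℕ} (3≤b : 3 ≤ b) (3≤n : 3 ≤ n) (base : Base b) (𝓕 : Family n) where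
  private
    module B = Base base
    module G = Family B.family
    module F = Family 𝓕

    pairs : ∀ i → Tiling (b + n) (PairChain (G.L i) (F.L i) (G.F i) (F.F i)) (concat (G.F i)) (concat (F.F i))
    pairs i = Product.productTiling 3≤b 3≤n
      (Decomposition.symmetric (G.decomposition i)) (B.marked i) (B.lengths i)
      (Decomposition.symmetric (F.decomposition i)) (F.short i) (All.tabulate id)

    module _ (i : Fin 3) where
      open Tiling (pairs i) public

    joined : Fin 3 → List (List (Subset (b + n)))
    joined i = map (map join) (chains i)

    -- New labels look at the first coordinate only, so their disjointness is inherited from the
    -- marks of the base.
    label : Fin 3 → Subset (b + n) → Set
    label i U = ∃ λ s → U ≡ join s × G.L i (proj₁ s)

    concat-joined : ∀ i → map join (concat (chains i)) ≡ concat (joined i)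
    concat-joined i = sym (concat-map (chains i))

    symmetric-join : ∀ {X : List (Subset b × Subset n)} → SymmetricChain₂ (b + n) X → SymmetricChain (map join X)
    symmetric-join (s , t , p , centred e) =
      join s , join t , path-map join-⋖ p , trans (cong₂ _+_ (∣join∣ s) (∣join∣ t)) e

    joined-decomposition : ∀ i → Decomposition (joined i)
    joined-decomposition i = record
      { symmetric = All.map⁺ (All.map (symmetric-join ∘ proj₁) (good i))
      ; unique    = subst Unique (concat-joined i) (Unique.map⁺ join-injective
          (↭ₛ.Unique-resp-↭ (setoid _) (↭⇒↭ₛ (↭-sym (tiles i)))
            (Unique.cartesianProduct⁺ (Decomposition.unique (G.decomposition i))
              (Decomposition.unique (F.decomposition i)))))
      ; complete  = complete′
      }
      where
      complete′ : ∀ U → U ∈ concat (joined i)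
      complete′ U with Vec.splitAt b U
      ... | S , T , refl = subst (join (S , T) ∈_) (concat-joined i) (∈-map⁺ join
        (∈-resp-↭ (↭-sym (tiles i)) (∈-cartesianProduct⁺
          (Decomposition.complete (G.decomposition i) S) (Decomposition.complete (F.decomposition i) T))))

    ∈-join⁻ : ∀ {s : Subset b × Subset n} {X} → join s ∈ map join X → s ∈ X
    ∈-join⁻ m with ∈-map⁻ join m
    ... | _ , k , e = subst (_∈ _) (sym (join-injective e)) k

    -- In each coordinate the two shared points agree or exchange `⊥` and `⊤`. If only one
    -- coordinate is exchanged, the other is marked or labelled for both `i` and `j`, against
    -- disjointness. If both are exchanged in opposite directions, a chain contains two incomparable
    -- corners. Otherwise the points are equal or are the joined `⊥` and `⊤`.
    joined-orthogonal : ∀ {i j} → i ≢ j → Orthogonal (joined i) (joined j)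
    joined-orthogonal {i} {j} i≢j A∈ B∈ S∈A T∈A S∈B T∈B
      with ∈-map⁻ (map join) A∈ | ∈-map⁻ (map join) B∈
    ... | X , X∈ , refl | Y , Y∈ , refl with ∈-map⁻ join S∈A | ∈-map⁻ join T∈A
    ... | (x , y) , s∈X , refl | (x′ , y′) , t∈X , refl =
      compare (G.orthogonal i≢j P.D∈ Q.D∈ (proj₁ (P.within s∈X)) (proj₁ (P.within t∈X))
                            (proj₁ (Q.within s∈Y)) (proj₁ (Q.within t∈Y)))
              (F.orthogonal i≢j P.C∈ Q.C∈ (proj₂ (P.within s∈X)) (proj₂ (P.within t∈X))
                            (proj₂ (Q.within s∈Y)) (proj₂ (Q.within t∈Y)))
              s∈X t∈X s∈Y t∈Y
      where
      module P = PairChain (proj₂ (All.lookup (good i) X∈))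
      module Q = PairChain (proj₂ (All.lookup (good j) Y∈))
      s∈Y : (x , y) ∈ Y
      s∈Y = ∈-join⁻ S∈B
      t∈Y : (x′ , y′) ∈ Y
      t∈Y = ∈-join⁻ T∈B

      compare : ∀ {x x′ y y′} →
                EqualOrExtreme x x′ → EqualOrExtreme y y′ →
                (x , y) ∈ X → (x′ , y′) ∈ X → (x , y) ∈ Y → (x′ , y′) ∈ Y →
                EqualOrExtreme (join (x , y)) (join (x′ , y′))
      compare (inj₁ refl) (inj₁ refl) _ _ _ _ = inj₁ refl
      compare (inj₁ refl) (inj₂ (inj₁ (refl , refl))) s t s′ t′ =
        ⊥-elim (G.disjoint i≢j (P.column s t) (Q.column s′ t′))
      compare (inj₁ refl) (inj₂ (inj₂ (refl , refl))) s t s′ t′ =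
        ⊥-elim (G.disjoint i≢j (P.column t s) (Q.column t′ s′))
      compare (inj₂ (inj₁ (refl , refl))) (inj₁ refl) s t s′ t′ =
        ⊥-elim (F.disjoint i≢j (P.row s t) (Q.row s′ t′))
      compare (inj₂ (inj₂ (refl , refl))) (inj₁ refl) s t s′ t′ =
        ⊥-elim (F.disjoint i≢j (P.row t s) (Q.row t′ s′))
      compare (inj₂ (inj₁ (refl , refl))) (inj₂ (inj₁ (refl , refl))) _ _ _ _ = inj₂ (inj₁ (join-⊥ b , join-⊤ b))
      compare (inj₂ (inj₂ (refl , refl))) (inj₂ (inj₂ (refl , refl))) _ _ _ _ = inj₂ (inj₂ (join-⊤ b , join-⊥ b))
      compare (inj₂ (inj₁ (refl , refl))) (inj₂ (inj₂ (refl , refl))) s t _ _ =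
        ⊥-elim (corners-incomparable 3≤b 3≤n P.symmetric s t)
      compare (inj₂ (inj₂ (refl , refl))) (inj₂ (inj₁ (refl , refl))) s t _ _ =
        ⊥-elim (corners-incomparable 3≤b 3≤n P.symmetric t s)

  product : Family (b + n)
  product = record
    { F             = joined
    ; L             = label
    ; decomposition = joined-decomposition
    ; short         = λ i → All.map⁺ (All.map (λ { {X} (_ , P) h →
        Any.map⁺ (Any.map (λ l → _ , refl , l) (PairChain.short P (subst (_≤ 2) (length-map join X) h))) }) (good i))
    ; disjoint      = λ { {i} {j} i≢j (s , refl , l) (t , e , l′) →
        G.disjoint i≢j l (subst (G.L j ∘ proj₁) (sym (join-injective e)) l′) }
    ; orthogonal    = joined-orthogonal
    }

-- Translation into the definitions of the statement.

path⇒Linked : ∀ {S T : Subset n} {C} → Path _⋖_ S T C → Linked _⊆_ C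
path⇒Linked stop          = [-]
path⇒Linked (r ◅ stop)    = ⋖⇒⊆ r ∷ [-]
path⇒Linked (r ◅ s ◅ p)   = ⋖⇒⊆ r ∷ path⇒Linked (s ◅ p)

path⇒sizes : ∀ {S T : Subset n} {C} → Path _⋖_ S T C → ∀ i → ∣ lookup C i ∣ ≡ ∣ S ∣ + toℕ i
path⇒sizes stop    Fin.zero    = sym (+-identityʳ _)
path⇒sizes (r ◅ p) Fin.zero    = sym (+-identityʳ _)
path⇒sizes (r ◅ p) (Fin.suc i) = trans (path⇒sizes p i) (trans (cong (_+ toℕ i) (size r)) (sym (+-suc _ _)))

path⇒Unique : ∀ {S T : Subset n} {C} → Path _⋖_ S T C → Unique C
path⇒Unique stop    = [] ∷ []
path⇒Unique (r ◅ p) = All.tabulate (λ { m refl → before-∉ r p m }) ∷ path⇒Unique p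

toIsSymmetricChain : ∀ {C} → SymmetricChain {n} C → IsSymmetricChain n C
toIsSymmetricChain {n} {C} (S , T , p , e) = record
  { j     = ∣ S ∣
  ; 2j≤n  = ≤-trans (+-monoʳ-≤ (∣ S ∣) (≤-trans (≤-reflexive (+-identityʳ _)) S≤T)) (≤-reflexive e)
  ; len   = begin
      length C                                              ≡⟨ m+n∸n≡m (length C) (∣ S ∣) ⟨
      length C + ∣ S ∣ ∸ ∣ S ∣                              ≡⟨ cong (_∸ ∣ S ∣) (path-size p) ⟩
      suc ∣ T ∣ ∸ ∣ S ∣                                     ≡⟨ +-∸-assoc 1 S≤T ⟩
      -- The summand 0 is introduced because `2 * ∣ S ∣` unfolds to `∣ S ∣ + (∣ S ∣ + 0)`.
      suc (∣ T ∣ ∸ ∣ S ∣)                                   ≡⟨ cong (λ k → suc (∣ T ∣ ∸ k)) (+-identityʳ (∣ S ∣)) ⟨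
      suc (∣ T ∣ ∸ (∣ S ∣ + 0))                             ≡⟨ cong suc ([m+n]∸[m+o]≡n∸o (∣ S ∣) (∣ T ∣) (∣ S ∣ + 0)) ⟨
      suc (∣ S ∣ + ∣ T ∣ ∸ 2 * ∣ S ∣)                       ≡⟨ cong (λ k → suc (k ∸ 2 * ∣ S ∣)) e ⟩
      suc (n ∸ 2 * ∣ S ∣)                                   ∎
  ; sizes = path⇒sizes p
  ; chain = path⇒Linked p
  }
  where
  open ≡-Reasoning
  S≤T : ∣ S ∣ ≤ ∣ T ∣
  S≤T = Size.first-≼ p (last∈ p)

Unique-++-disjoint : ∀ {xs ys : List A} {x} → Unique (xs ++ ys) → x ∈ xs → x ∉ ys
Unique-++-disjoint {xs = _ ∷ xs} (h ∷ u) (here refl) k = All.lookup h (∈-++⁺ʳ xs k) refl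
Unique-++-disjoint (h ∷ u) (there m)   k = Unique-++-disjoint u m k

Unique-++ʳ : ∀ (xs : List A) {ys} → Unique (xs ++ ys) → Unique ys
Unique-++ʳ []       u       = u
Unique-++ʳ (_ ∷ xs) (_ ∷ u) = Unique-++ʳ xs u

block-unique : ∀ (xss : List (List A)) {x} → Unique (concat xss) →
               ∀ i k → x ∈ lookup xss i → x ∈ lookup xss k → k ≡ i
block-unique (xs ∷ xss) u Fin.zero    Fin.zero    m m′ = refl
block-unique (xs ∷ xss) u Fin.zero    (Fin.suc k) m m′ =
  ⊥-elim (Unique-++-disjoint u m (∈-concat⁺′ m′ (∈-lookup {xs = xss} k)))
block-unique (xs ∷ xss) u (Fin.suc i) Fin.zero    m m′ =
  ⊥-elim (Unique-++-disjoint u m′ (∈-concat⁺′ m (∈-lookup {xs = xss} i)))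
block-unique (xs ∷ xss) u (Fin.suc i) (Fin.suc k) m m′ = cong Fin.suc (block-unique xss (Unique-++ʳ xs u) i k m m′)

toIsSCD : ∀ {F} → Decomposition {n} F → IsSCD n F
toIsSCD {F = F} d = record
  { symmetric = λ i → toIsSymmetricChain (All.lookup (Decomposition.symmetric d) (∈-lookup i))
  ; partition = λ S →
      let k = ∈-concat⁻ F (Decomposition.complete d S)
      in Any.index k , Any.lookup-index k , λ l m →
           block-unique F (Decomposition.unique d) (Any.index k) l (Any.lookup-index k) m
  }

pair-length : ∀ {x y : A} {xs} → x ≢ y → x ∈ xs → y ∈ xs → Unique xs →
              (∀ {z} → z ∈ xs → z ≡ x ⊎ z ≡ y) → length xs ≡ 2
pair-length {xs = _ ∷ []}         x≢y (here refl) (here refl) u h = ⊥-elim (x≢y refl)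
pair-length {xs = _ ∷ _ ∷ []}     x≢y _ _ u h = refl
pair-length {xs = _ ∷ _ ∷ _ ∷ _} x≢y _ _ ((a≢b ∷ a≢c ∷ _) ∷ (b≢c ∷ _) ∷ _) h
  with h (here refl) | h (there (here refl)) | h (there (there (here refl)))
... | inj₁ refl | inj₁ refl | _         = ⊥-elim (a≢b refl)
... | inj₁ refl | inj₂ refl | inj₁ refl = ⊥-elim (a≢c refl)
... | inj₁ refl | inj₂ refl | inj₂ refl = ⊥-elim (b≢c refl)
... | inj₂ refl | inj₁ refl | inj₁ refl = ⊥-elim (b≢c refl)
... | inj₂ refl | inj₁ refl | inj₂ refl = ⊥-elim (a≢c refl)
... | inj₂ refl | inj₂ refl | _         = ⊥-elim (a≢b refl)

-- Two distinct shared points can only be `⊥` and `⊤`, and sharing these makes both chains full.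
toAlmostOrthogonal : ∀ {F G} → 3 ≤ n → Decomposition {n} F → Orthogonal F G → AlmostOrthogonal n F G
toAlmostOrthogonal {n} {F} {G} 3≤n d o i j = exactlyTwo , atMostOne
  where
  A∩B : List (Subset n)
  A∩B = filter (λ S → DecMembership._∈?_ _≟S_ S (lookup G j)) (lookup F i)

  ∩-unique : Unique A∩B
  ∩-unique with All.lookup (Decomposition.symmetric d) (∈-lookup i)
  ... | _ , _ , p , _ = Unique.filter⁺ _ (path⇒Unique p)

  compare : ∀ {S T} → S ∈ A∩B → T ∈ A∩B → EqualOrExtreme S T
  compare s t with ∈-filter⁻ _ {xs = lookup F i} s | ∈-filter⁻ _ {xs = lookup F i} t
  ... | s∈A , s∈B | t∈A , t∈B = o (∈-lookup i) (∈-lookup j) s∈A t∈A s∈B t∈B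

  full : ⊥ ∈ A∩B → ⊤ ∈ A∩B → IsFullChain (lookup F i) × IsFullChain (lookup G j)
  full m k with ∈-filter⁻ _ {xs = lookup F i} m | ∈-filter⁻ _ {xs = lookup F i} k
  ... | m∈A , m∈B | k∈A , k∈B = (m∈A , k∈A) , (m∈B , k∈B)

  ⊥≢⊤ : ⊥ {n} ≢ ⊤
  ⊥≢⊤ e = ⊤≰⊥ 3≤n (≤-reflexive (cong ∣_∣ (sym e)))

  exactlyTwo : IsFullChain (lookup F i) × IsFullChain (lookup G j) → length A∩B ≡ 2
  exactlyTwo ((m∈A , k∈A) , (m∈B , k∈B)) = pair-length ⊥≢⊤ m k ∩-unique corner
    where
    m : ⊥ ∈ A∩B
    m = ∈-filter⁺ _ m∈A m∈B
    k : ⊤ ∈ A∩B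
    k = ∈-filter⁺ _ k∈A k∈B
    corner : ∀ {S} → S ∈ A∩B → S ≡ ⊥ ⊎ S ≡ ⊤
    corner s with compare s m
    ... | inj₁ e              = inj₁ e
    ... | inj₂ (inj₁ (e , _)) = inj₁ e
    ... | inj₂ (inj₂ (e , _)) = inj₂ e

  atMostOne : ¬ (IsFullChain (lookup F i) × IsFullChain (lookup G j)) → length A∩B ≤ 1
  atMostOne ¬full = go A∩B ∩-unique compare full
    where
    go : ∀ U → Unique U → (∀ {S T} → S ∈ U → T ∈ U → EqualOrExtreme S T) →
         (⊥ ∈ U → ⊤ ∈ U → IsFullChain (lookup F i) × IsFullChain (lookup G j)) → length U ≤ 1
    go []          _             _ _ = z≤n
    go (_ ∷ [])    _             _ _ = s≤s z≤n
    go (_ ∷ _ ∷ _) ((S≢T ∷ _) ∷ _) c f with c (here refl) (there (here refl))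
    ... | inj₁ e                    = contradiction e S≢T
    ... | inj₂ (inj₁ (refl , refl)) = contradiction (f (here refl) (there (here refl))) ¬full
    ... | inj₂ (inj₂ (refl , refl)) = contradiction (f (there (here refl)) (here refl)) ¬full

-- Deciding the conditions on a base.

infix 4 _∈?_
_∈?_ : (S : Subset n) (C : List (Subset n)) → Dec (S ∈ C)
_∈?_ = DecMembership._∈?_ _≟S_

_⋖?_ : (S T : Subset n) → Dec (S ⋖ T)
S ⋖? T with S ⊆? T | ∣ T ∣ ℕ.≟ suc ∣ S ∣
... | yes h | yes e = yes (cover h e)
... | no ¬h | _     = no (¬h ∘ λ r {x} → ⋖⇒⊆ r {x})
... | yes _ | no ¬e = no (¬e ∘ size)

path? : (S : Subset n) (C : List (Subset n)) → Dec (∃ λ T → Path _⋖_ S T (S ∷ C))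
path? S [] = yes (S , stop)
path? S (T ∷ C) = map′ (λ { (r , U , p) → U , r ◅ p }) inverse ((S ⋖? T) ×-dec path? T C)
  where
  inverse : (∃ λ U → Path _⋖_ S U (S ∷ T ∷ C)) → S ⋖ T × ∃ λ U → Path _⋖_ T U (T ∷ C)
  inverse (U , r ◅ stop)  = r , U , stop
  inverse (U , r ◅ s ◅ p) = r , U , s ◅ p

-- Needed for refutation: `symmetricChain?` computes one endpoint, and its failing the size test
-- must exclude every other witness.
end-unique : ∀ {S T T′ : Subset n} {C} → Path _⋖_ S T C → Path _⋖_ S T′ C → T ≡ T′
end-unique stop        stop        = refl
end-unique (_ ◅ stop)  (_ ◅ stop)  = refl
end-unique (_ ◅ p@(_ ◅ _)) (_ ◅ q@(_ ◅ _)) = end-unique p q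

symmetricChain? : (C : List (Subset n)) → Dec (SymmetricChain C)
symmetricChain? [] = no λ ()
symmetricChain? {n} (S ∷ C) with path? S C
... | no ¬p = no λ { (_ , T , stop , _) → ¬p (T , stop) ; (_ , T , r ◅ p , _) → ¬p (T , r ◅ p) }
... | yes (T , p) = map′ (λ e → S , T , p , e) inverse (∣ S ∣ + ∣ T ∣ ℕ.≟ n)
  where
  inverse : SymmetricChain (S ∷ C) → ∣ S ∣ + ∣ T ∣ ≡ n
  inverse (_ , U , q@stop , e)    = trans (cong (λ V → ∣ S ∣ + ∣ V ∣) (end-unique p q)) e
  inverse (_ , U , q@(_ ◅ _) , e) = trans (cong (λ V → ∣ S ∣ + ∣ V ∣) (end-unique p q)) e

-- Completeness is phrased as the absence of a missing set, since `anySubset?` decides existence;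
-- decidability of membership undoes the double negation. The test `S ∈ B` precedes the quantifier
-- over `T`, which is then skipped for every `S` outside `B`.
Check : {b : ℕ} → (Fin 3 → List (List (Subset b))) → (Fin 3 → List (Subset b)) → Set
Check G M =
  (∀ i → All SymmetricChain (G i) × Unique (concat (G i)) × (¬ ∃ λ S → S ∉ concat (G i)) ×
         All (Any (_∈ M i)) (G i) × All (λ D → length D ≡ 2 ⊎ 4 ≤ length D) (G i)) ×
  (∀ i j → i ≢ j → All (_∉ M j) (M i) ×
     All (λ A → All (λ B → All (λ S → S ∈ B → All (λ T → T ∈ B →
       EqualOrExtreme S T) A) A) (G j)) (G i))

check? : ∀ {b} G M → Dec (Check {b} G M)
check? G M =
  Fin.all? (λ i → all? symmetricChain? (G i) ×-dec unique? _≟S_ (concat (G i)) ×-dec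
                  ¬? (anySubset? λ S → ¬? (S ∈? concat (G i))) ×-dec
                  all? (any? (_∈? M i)) (G i) ×-dec all? (λ D → (length D ℕ.≟ 2) ⊎-dec (4 ≤? length D)) (G i)) ×-dec
  Fin.all? (λ i → Fin.all? λ j → ¬? (i Fin.≟ j) →-dec
    (all? (λ S → ¬? (S ∈? M j)) (M i) ×-dec
     all? (λ A → all? (λ B → all? (λ S → (S ∈? B) →-dec all? (λ T → (T ∈? B) →-dec
       ((S ≟S T) ⊎-dec ((S ≟S ⊥) ×-dec (T ≟S ⊤)) ⊎-dec ((S ≟S ⊤) ×-dec (T ≟S ⊥)))) A) A) (G j)) (G i)))

verifiedBase : ∀ {b} G M → Check {b} G M → Base b
verifiedBase G M (c , o) = record
  { family = record
    { F             = G
    ; L             = λ i → _∈ M i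
    ; decomposition = λ i → let s , u , ¬missing , _ = c i in record
        { symmetric = s
        ; unique    = u
        ; complete  = λ S → decidable-stable (S ∈? concat (G i)) λ S∉ → ¬missing (S , S∉)
        }
    ; short         = λ i → let _ , _ , _ , m , _ = c i in All.map (λ a _ → a) m
    ; disjoint      = λ {i} {j} i≢j → All.lookup (proj₁ (o i j i≢j))
    ; orthogonal    = λ {i} {j} i≢j A∈ B∈ S∈A T∈A S∈B T∈B →
        All.lookup (All.lookup (All.lookup (All.lookup (proj₂ (o i j i≢j)) A∈) B∈) S∈A S∈B) T∈A T∈B
    }
  ; marked  = λ i → let _ , _ , _ , m , _ = c i in m
  ; lengths = λ i → let _ , _ , _ , _ , l = c i in l
  }

-- Sets are coded by numbers: i ∈ bits n k iff the binary digit of weight 2 ^ i in k is 1.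
bits : (n : ℕ) → ℕ → Subset n
bits zero    k = Vec.[]
bits (suc n) k = (k % 2 ≡ᵇ 1) Vec.∷ bits n (k / 2)

rotate : Subset n → Subset n
rotate Vec.[]       = Vec.[]
rotate (x Vec.∷ xs) = xs Vec.∷ʳ x

rotations : List ℕ → List (List (Subset n))
rotations {n} ks = iterate (map rotate) (map (bits n) ks) n

-- The orbits of the given chains under cyclic shifts of [n], where the first chain of the first orbit is
-- extended by ⊥ and ⊤ to a full chain.
rotational : List ℕ → List (List ℕ) → List (List (Subset n))
rotational {n} ks kss = (⊥ ∷ map (bits n) ks ++ ⊤ ∷ []) ∷ drop 1 (rotations ks) ++ concatMap rotations kss

-- The marks M i of G i form a union of necklaces: rotations is applied to a list of necklace representatives,
-- which need not be a chain.
base₅ : Base 5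
base₅ = verifiedBase G M (toWitness {a? = check? G M} _)
  where
  G : Fin 3 → List (List (Subset 5))
  G 0F = rotational (1 ∷ 9 ∷ 11 ∷ 15 ∷ []) ((3 ∷ 7 ∷ []) ∷ [])
  G 1F = rotational (8 ∷ 24 ∷ 28 ∷ 29 ∷ []) ((5 ∷ 21 ∷ []) ∷ [])
  G 2F = rotational (4 ∷ 6 ∷ 22 ∷ 23 ∷ []) ((5 ∷ 7 ∷ []) ∷ [])
  M : Fin 3 → List (Subset 5)
  M 0F = concat (rotations (1 ∷ 7 ∷ []))
  M 1F = concat (rotations (15 ∷ 11 ∷ []))
  M 2F = concat (rotations (3 ∷ 5 ∷ []))

-- As 7 is prime, every set other than `⊥` and `⊤` has seven rotations. Each decomposition consists
-- of one orbit of chains starting at size 1, two at size 2 and two at size 3, which accounts for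
-- the 7, 21 and 35 sets of these sizes; the marks supply one necklace for each of the five orbits.
base₇ : Base 7
base₇ = verifiedBase G M (toWitness {a? = check? G M} _)
  where
  G : Fin 3 → List (List (Subset 7))
  G 0F = rotational (1 ∷ 65 ∷ 67 ∷ 75 ∷ 107 ∷ 111 ∷ [])
    ((9 ∷ 13 ∷ 77 ∷ 79 ∷ []) ∷ (5 ∷ 21 ∷ 53 ∷ 55 ∷ []) ∷ (19 ∷ 83 ∷ []) ∷ (11 ∷ 15 ∷ []) ∷ [])
  G 1F = rotational (2 ∷ 10 ∷ 26 ∷ 58 ∷ 122 ∷ 126 ∷ [])
    ((9 ∷ 73 ∷ 75 ∷ 91 ∷ []) ∷ (3 ∷ 67 ∷ 71 ∷ 79 ∷ []) ∷ (21 ∷ 85 ∷ []) ∷ (11 ∷ 27 ∷ []) ∷ [])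
  G 2F = rotational (8 ∷ 24 ∷ 25 ∷ 89 ∷ 91 ∷ 95 ∷ [])
    ((5 ∷ 69 ∷ 85 ∷ 117 ∷ []) ∷ (9 ∷ 41 ∷ 57 ∷ 121 ∷ []) ∷ (13 ∷ 15 ∷ []) ∷ (7 ∷ 39 ∷ []) ∷ [])
  M : Fin 3 → List (Subset 7)
  M 0F = concat (rotations (1 ∷ 31 ∷ 21 ∷ 19 ∷ 11 ∷ []))
  M 1F = concat (rotations (29 ∷ 23 ∷ 15 ∷ 43 ∷ 27 ∷ []))
  M 2F = concat (rotations (3 ∷ 5 ∷ 9 ∷ 13 ∷ 7 ∷ []))

-- All dimensions from 24 on.

private
  3≤3+ : ∀ {k} → 3 ≤ 3 + k
  3≤3+ = s≤s (s≤s (s≤s z≤n))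

extend₅ : ∀ {k} → Family (3 + k) → Family (5 + (3 + k))
extend₅ = product 3≤3+ 3≤3+ base₅

extend₇ : ∀ {k} → Family (3 + k) → Family (7 + (3 + k))
extend₇ = product 3≤3+ 3≤3+ base₇

-- The largest number not of the form 5x + 7y is 23. The five values 24 to 28 represent all residues
-- modulo 5, and every later dimension follows by adding 5.
families : ∀ k → Family (24 + k)
families 0 = extend₅ (extend₇ (extend₇ (Base.family base₅)))
families 1 = extend₅ (extend₅ (extend₅ (extend₅ (Base.family base₅))))
families 2 = extend₇ (extend₇ (extend₇ (Base.family base₅)))
families 3 = extend₇ (extend₅ (extend₅ (extend₅ (Base.family base₅))))
families 4 = extend₇ (extend₇ (extend₇ (Base.family base₇)))
families (suc (suc (suc (suc (suc k))))) = extend₅ (families k)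

theorem3p1 : Σ ℕ λ N₀ → (n : ℕ) → N₀ ≤ n →
    Σ (List (List (Subset n))) λ F₁ → Σ (List (List (Subset n))) λ F₂ → Σ (List (List (Subset n))) λ F₃ →
    IsSCD n F₁ × IsSCD n F₂ × IsSCD n F₃ ×
    AlmostOrthogonal n F₁ F₂ × AlmostOrthogonal n F₁ F₃ × AlmostOrthogonal n F₂ F₃
theorem3p1 = 24 , λ n 24≤n → fromFamily (m≤n⇒∃[o]m+o≡n 24≤n)
  where
  fromFamily : ∀ {n} → (∃ λ k → 24 + k ≡ n) →
    Σ (List (List (Subset n))) λ F₁ → Σ (List (List (Subset n))) λ F₂ → Σ (List (List (Subset n))) λ F₃ →
    IsSCD n F₁ × IsSCD n F₂ × IsSCD n F₃ ×
    AlmostOrthogonal n F₁ F₂ × AlmostOrthogonal n F₁ F₃ × AlmostOrthogonal n F₂ F₃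
  fromFamily (k , refl) =
    F 0F , F 1F , F 2F ,
    toIsSCD (decomposition 0F) , toIsSCD (decomposition 1F) , toIsSCD (decomposition 2F) ,
    toAlmostOrthogonal 3≤3+ (decomposition 0F) (orthogonal λ ()) ,
    toAlmostOrthogonal 3≤3+ (decomposition 0F) (orthogonal λ ()) ,
    toAlmostOrthogonal 3≤3+ (decomposition 1F) (orthogonal λ ())
    where open Family (families k)
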